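{- Let $P, Q$ be nonzero real numbers with $\Delta := P^2 - 4Q > 0$, and let $(U_n)_{n\in\mathbb{Z}}$ and $\beta$ be as in the context. Let $(a_n)_{n \geq 1}$ be a strictly increasing sequence of positive integers. Then both series below converge and $$\sum_{n = 1}^{+\infty} (-1)^n \frac{\beta^{a_n}}{U_{a_n}} = - \sum_{n = 1}^{+\infty} Q^{a_{2n - 1}} \frac{U_{a_{2n} - a_{2n - 1}}}{U_{a_{2n}} U_{a_{2n - 1}}}.$$
   Context: $P, Q$ are fixed nonzero real numbers with $\Delta := P^2 - 4Q > 0$. $\alpha$ and $\beta$ denote the two real roots of $X^2 - PX + Q = 0$, labelled so that $|\alpha| > |\beta|$ (the absolute values are distinct because $P \neq 0$ and $\Delta > 0$). The Lucas sequence of the first kind $(U_n)_{n \in \mathbb{Z}}$ is defined by $U_0 = 0$, $U_1 = 1$ and $U_{n+2} = P U_{n+1} - Q U_n$ for all $n \in \mathbb{Z}$; equivalently $U_n = \frac{\alpha^n - \beta^n}{\alpha - \beta}$. -}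

module Defs where

open import Level using (suc) renaming (_⊔_ to _⊔ˡ_)
open import Data.Integer.Base using (ℤ; 0ℤ; 1ℤ) renaming (_+_ to _+ᶻ_)
open import Data.Nat.Base as ℕ using (ℕ; NonZero; _∸_) renaming (_*_ to _*ⁿ_)
open import Data.Product.Base using (∃-syntax; proj₁)
open import Data.Nat.Properties using (+-suc)
open import Data.Sum.Base using (_⊎_)
open import Function.Bundles using (_⇔_)
open import Relation.Binary.Core using (Rel)
open import Relation.Binary.Structures using (IsStrictPartialOrder)
open import Relation.Binary.Lattice.Definitions using (Supremum)
open import Relation.Binary.PropositionalEquality.Core using (subst; sym)
open import Relation.Nullary.Negation using (¬_)
open import Algebra.Core using (Op₁; Op₂)
open import Algebra.Bundles using (CommutativeRing)
open import Algebra.Apartness.Bundles using (HeytingField; HeytingCommutativeRing)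
import Algebra.Apartness.Properties.HeytingCommutativeRing as HCR
import Algebra.Properties.Semiring.Exp as Exp
import Algebra.Properties.Semiring.Mult as Mult

-- A Heyting field with a compatible strict order whose apartness is
-- "less or greater", and with binary maxima (needed for absolute values).
-- Weak linearity (x < y implies x < z or z < y) follows from cotransitivity
-- of apartness, and 0# < 1# follows from 1# # 0#.

record OrderedField c ℓ₁ ℓ₂ : Set (suc (c ⊔ˡ ℓ₁ ⊔ˡ ℓ₂)) where
  field
    heytingField : HeytingField c ℓ₁ ℓ₂

  open HeytingField heytingField public

  infix  4 _<_ _≤_
  infixr 5 _⊔_

  field
    _<_                  : Rel Carrier ℓ₂
    isStrictPartialOrder : IsStrictPartialOrder _≈_ _<_
    #⇔<⊎>                : ∀ {x y} → x # y ⇔ (x < y ⊎ y < x)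
    +-monoˡ-<            : ∀ {x y} z → x < y → x + z < y + z
    *-pos                : ∀ {x y} → 0# < x → 0# < y → 0# < x * y

  _≤_ : Rel Carrier ℓ₂
  x ≤ y = ¬ (y < x)

  field
    _⊔_      : Op₂ Carrier
    supremum : Supremum _≤_ _⊔_

  open HeytingCommutativeRing heytingCommutativeRing public
    using (commutativeRing)
  open CommutativeRing commutativeRing public using (semiring)
  open Exp semiring public using (_^_)
  open Mult semiring public using () renaming (_×_ to _·_)
  open HCR heytingCommutativeRing public using (x#0y#0→xy#0)

  ∣_∣ : Op₁ Carrier
  ∣ x ∣ = x ⊔ (- x)

  -- #⇒invertible inverts y - 0#, which is y.
  infixl 7 _/_[_]
  _/_[_] : (x y : Carrier) → y # 0# → Carrier
  x / y [ y#0 ] = x * proj₁ (#⇒invertible y#0)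

  infix 4 _⟶_
  _⟶_ : (ℕ → Carrier) → Carrier → Set (c ⊔ˡ ℓ₂)
  x ⟶ l = ∀ ε → 0# < ε → ∃[ N ] (∀ n → N ℕ.≤ n → ∣ x n - l ∣ < ε)

  IsCauchy : (ℕ → Carrier) → Set (c ⊔ˡ ℓ₂)
  IsCauchy x = ∀ ε → 0# < ε →
    ∃[ N ] (∀ m n → N ℕ.≤ m → N ℕ.≤ n → ∣ x m - x n ∣ < ε)

  -- Series are indexed from 1.
  partialSum : ((n : ℕ) → .{{NonZero n}} → Carrier) → ℕ → Carrier
  partialSum f ℕ.zero    = 0#
  partialSum f (ℕ.suc n) = partialSum f n + f (ℕ.suc n)

  HasSum : ((n : ℕ) → .{{NonZero n}} → Carrier) → Carrier → Set (c ⊔ˡ ℓ₂)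
  HasSum f s = partialSum f ⟶ s

  record IsLucasSequence (P Q : Carrier) (U : ℤ → Carrier) : Set ℓ₁ where
    field
      U₀≈0       : U 0ℤ ≈ 0#
      U₁≈1       : U 1ℤ ≈ 1#
      recurrence : ∀ n → U (n +ᶻ 1ℤ +ᶻ 1ℤ) ≈ P * U (n +ᶻ 1ℤ) - Q * U n

-- The real numbers: a Cauchy complete Archimedean ordered field. Classically
-- these axioms determine ℝ up to isomorphism; constructively they hold for
-- Bishop's reals, where _#_ and _<_ carry a rational witness and a Cauchy
-- sequence comes with its modulus.

record RealNumbers c ℓ₁ ℓ₂ : Set (suc (c ⊔ˡ ℓ₁ ⊔ˡ ℓ₂)) where
  field
    orderedField : OrderedField c ℓ₁ ℓ₂

  open OrderedField orderedField public

  field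
    archimedean : ∀ x → ∃[ n ] x < n · 1#
    complete    : ∀ x → IsCauchy x → ∃[ l ] x ⟶ l

2n≢0 : ∀ n → .{{NonZero n}} → NonZero (2 *ⁿ n)
2n≢0 (ℕ.suc n) = _

2n∸1≢0 : ∀ n → .{{NonZero n}} → NonZero (2 *ⁿ n ∸ 1)
2n∸1≢0 (ℕ.suc n) = subst NonZero (sym (+-suc n (n ℕ.+ 0))) _

module Submission where

-- With ρ = β / α and δ = α - β, Binet's formula δ Uₙ = αⁿ - βⁿ gives βⁿ / Uₙ = δ ρⁿ / (1 - ρⁿ).
-- Since 0 < |ρ| < 1, this is at most |δ| |ρ|ⁿ / (1 - |ρ|) in absolute value, and aₙ ≥ n, so the left
-- series is dominated by a geometric one. Binet's formula also gives
-- βᵏ / Uₖ - βᵐ / Uₘ = Qᵏ Uₘ₋ₖ / (Uₘ Uₖ) for k ≤ m, so the n-th partial sum on the right, with its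
-- sign, is the 2n-th partial sum on the left.

open import Defs
open import Algebra.Bundles using (CommutativeRing)
open import Algebra.Solver.Ring.AlmostCommutativeRing
  using (fromCommutativeRing; _-Raw-AlmostCommutative⟶_)
open import Data.Integer.Base as ℤ using (ℤ; +_; -[1+_]; 0ℤ; 1ℤ; _⊖_) renaming (_-_ to _-ᶻ_)
open import Data.Maybe.Base using (Maybe; just; nothing)
open import Data.Nat.Base as ℕ using (ℕ; zero; suc; NonZero; _∸_; s≤s) renaming (_*_ to _*ⁿ_; _<_ to _<ⁿ_)
open import Data.Product.Base using (Σ-syntax; ∃-syntax; _×_; _,_; proj₁; proj₂)
open import Data.Sum.Base using (_⊎_; inj₁; inj₂; [_,_]′)
open import Function.Base using (_∘_)
open import Function.Bundles using (module Equivalence)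
open import Relation.Binary.PropositionalEquality as ≡ using (_≡_)
open import Relation.Binary.Structures using (IsStrictPartialOrder; IsPreorder)
open import Relation.Nullary.Decidable using (yes; no)
open import Relation.Nullary.Negation using (contradiction)
import Algebra.Apartness.Properties.HeytingCommutativeRing as HeytingProperties
import Algebra.Properties.AbelianGroup as AbelianGroupProperties
import Algebra.Properties.CommutativeSemiring.Exp as CommutativeExp
import Algebra.Properties.Ring as RingProperties
import Algebra.Properties.Semiring.Exp as Exp
import Algebra.Properties.Semiring.Mult.TCOptimised as Mult
import Algebra.Solver.Ring as RingSolver
import Data.Integer.Properties as ℤ
import Data.Nat.Properties as ℕ
import Relation.Binary.Reasoning.Base.Triple as TripleReasoning
import Relation.Binary.Reasoning.Setoid as SetoidReasoning

-- The axioms are constructive: `x ≤ y` is the negation of `y < x`, and `≈` amounts to the negation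
-- of `#`. Hence signs may be distinguished only while proving a `≤`, equalities of absolute values
-- go through antisymmetry, and a strict inequality or an apartness needs positive evidence. In
-- particular every denominator `U (+ a n)` has to be shown apart from zero; the evidence is the
-- bound `1 - ρⁿ ≥ 1 - ∣ρ∣ > 0`, uniform in `n ≥ 1`, which then also controls the size of the terms.
-- Estimates and identities are multiplied out instead of divided: a quotient `x` of `βⁿ` by `Uₙ`
-- enters as a solution of `Uₙ * x ≈ βⁿ`, and the factor `1 - ∣ρ∣` stays on the left of each bound.
-- Completeness is invoked once, for the left series; the right one inherits its limit.

-- The library's solvers cannot see that coefficients cancel in a ring without decidable equality;
-- integer coefficients make this decidable.
module IntegerCoefficients {c ℓ} (R : CommutativeRing c ℓ) where
  open CommutativeRing R
  open RingProperties ring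
  open AbelianGroupProperties +-abelianGroup using (⁻¹-∙-comm)
  open Mult semiring using (×-homo-+; ×1-homo-*; 1+×) renaming (_×_ to _·_)
  open SetoidReasoning setoid

  -- This multiple `_·_` makes `1 · 1#` reduce to `1#`, so that `con 1ℤ` in a solver equation is
  -- `1#` by definition and `refl` closes the goals.
  fromℤ : ℤ → Carrier
  fromℤ (+ n)    = n · 1#
  fromℤ -[1+ n ] = - (suc n · 1#)

  x-x′≈[z+x]-[z+x′] : ∀ x x′ z → x - x′ ≈ (z + x) - (z + x′)
  x-x′≈[z+x]-[z+x′] x x′ z = begin
    x - x′                   ≈⟨ +-congʳ (xyx⁻¹≈y z x) ⟨
    (z + x - z) - x′         ≈⟨ +-assoc _ _ _ ⟩
    z + x + (- z - x′)       ≈⟨ +-congˡ (⁻¹-∙-comm z x′) ⟩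
    (z + x) - (z + x′)       ∎

  fromℤ-⊖ : ∀ m n → fromℤ (m ⊖ n) ≈ m · 1# - n · 1#
  fromℤ-⊖ zero    zero    = sym (-‿inverseʳ 0#)
  fromℤ-⊖ zero    (suc n) = sym (+-identityˡ _)
  fromℤ-⊖ (suc m) zero    = sym (trans (+-congˡ -0#≈0#) (+-identityʳ _))
  fromℤ-⊖ (suc m) (suc n) = begin
    fromℤ (suc m ⊖ suc n)             ≡⟨ ≡.cong fromℤ (ℤ.[1+m]⊖[1+n]≡m⊖n m n) ⟩
    fromℤ (m ⊖ n)                     ≈⟨ fromℤ-⊖ m n ⟩
    m · 1# - n · 1#                   ≈⟨ x-x′≈[z+x]-[z+x′] _ _ 1# ⟩
    (1# + m · 1#) - (1# + n · 1#)     ≈⟨ +-cong (1+× m 1#) (-‿cong (1+× n 1#)) ⟨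
    suc m · 1# - suc n · 1#           ∎

  fromℤ-+ : ∀ i j → fromℤ (i ℤ.+ j) ≈ fromℤ i + fromℤ j
  fromℤ-+ (+ m)    (+ n)    = ×-homo-+ 1# m n
  fromℤ-+ (+ m)    -[1+ n ] = fromℤ-⊖ m (suc n)
  fromℤ-+ -[1+ m ] (+ n)    = trans (fromℤ-⊖ n (suc m)) (+-comm _ _)
  fromℤ-+ -[1+ m ] -[1+ n ] = begin
    - (suc (suc (m ℕ.+ n)) · 1#)          ≡⟨ ≡.cong (λ k → - (k · 1#)) (≡.cong suc (≡.sym (ℕ.+-suc m n))) ⟩
    - ((suc m ℕ.+ suc n) · 1#)            ≈⟨ -‿cong (×-homo-+ 1# (suc m) (suc n)) ⟩
    - (suc m · 1# + suc n · 1#)           ≈⟨ ⁻¹-∙-comm _ _ ⟨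
    - (suc m · 1#) - suc n · 1#           ∎

  fromℤ-neg : ∀ i → fromℤ (ℤ.- i) ≈ - fromℤ i
  fromℤ-neg (+ zero)  = sym -0#≈0#
  fromℤ-neg (+ suc n) = refl
  fromℤ-neg -[1+ n ]  = sym (-‿involutive _)

  fromℤ-*-pos : ∀ m j → fromℤ (+ m ℤ.* j) ≈ m · 1# * fromℤ j
  fromℤ-*-pos m (+ n) = begin
    fromℤ (+ m ℤ.* + n)     ≡⟨ ≡.cong fromℤ (ℤ.pos-* m n) ⟨
    (m ℕ.* n) · 1#          ≈⟨ ×1-homo-* m n ⟩
    m · 1# * n · 1#         ∎
  fromℤ-*-pos m -[1+ n ] = begin
    fromℤ (+ m ℤ.* -[1+ n ])         ≡⟨ ≡.cong fromℤ (ℤ.neg-distribʳ-* (+ m) (+ suc n)) ⟨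
    fromℤ (ℤ.- (+ m ℤ.* + suc n))    ≈⟨ fromℤ-neg (+ m ℤ.* + suc n) ⟩
    - fromℤ (+ m ℤ.* + suc n)        ≈⟨ -‿cong (fromℤ-*-pos m (+ suc n)) ⟩
    - (m · 1# * suc n · 1#)          ≈⟨ -‿distribʳ-* _ _ ⟩
    m · 1# * - (suc n · 1#)          ∎

  fromℤ-* : ∀ i j → fromℤ (i ℤ.* j) ≈ fromℤ i * fromℤ j
  fromℤ-* (+ m)    j = fromℤ-*-pos m j
  fromℤ-* -[1+ m ] j = begin
    fromℤ (-[1+ m ] ℤ.* j)           ≡⟨ ≡.cong fromℤ (ℤ.neg-distribˡ-* (+ suc m) j) ⟨
    fromℤ (ℤ.- (+ suc m ℤ.* j))      ≈⟨ fromℤ-neg (+ suc m ℤ.* j) ⟩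
    - fromℤ (+ suc m ℤ.* j)          ≈⟨ -‿cong (fromℤ-*-pos (suc m) j) ⟩
    - (suc m · 1# * fromℤ j)         ≈⟨ -‿distribˡ-* _ _ ⟩
    - (suc m · 1#) * fromℤ j         ∎

  fromℤ-homomorphism : ℤ.+-*-rawRing -Raw-AlmostCommutative⟶ fromCommutativeRing R
  fromℤ-homomorphism = record
    { ⟦_⟧    = fromℤ
    ; +-homo = fromℤ-+
    ; *-homo = fromℤ-*
    ; -‿homo = fromℤ-neg
    ; 0-homo = refl
    ; 1-homo = refl
    }

  fromℤ-≟ : ∀ i j → Maybe (fromℤ i ≈ fromℤ j)
  fromℤ-≟ i j with i ℤ.≟ j
  ... | yes i≡j = just (reflexive (≡.cong fromℤ i≡j))
  ... | no  _   = nothing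

  open RingSolver ℤ.+-*-rawRing (fromCommutativeRing R) fromℤ-homomorphism fromℤ-≟ public
    using (solve; con; _:=_; _:+_; _:*_; :-_; _:-_)

-- Order, apartness and absolute value in a constructive ordered field.

module OrderedFieldProperties {c ℓ₁ ℓ₂} (F : OrderedField c ℓ₁ ℓ₂) where
  open OrderedField F
  open IntegerCoefficients commutativeRing public using (solve; con; _:=_; _:+_; _:*_; :-_; _:-_)
  open HeytingProperties heytingCommutativeRing public
    using (x-0≈x; 1#0; invertibleˡ⇒#; #-congʳ)
  open CommutativeRing commutativeRing public using (ring)
  open RingProperties ring public using (-‿involutive; -0#≈0#; x[y-z]≈xy-xz)
  open IsStrictPartialOrder isStrictPartialOrder public
    using (<-resp-≈)
    renaming (irrefl to <-irrefl; trans to <-trans; asym to <-asym; <-respʳ-≈ to <-respʳ; <-respˡ-≈ to <-respˡ)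

  private variable
    x y z w ε : Carrier

  <⇒# : x < y → x # y
  <⇒# = Equivalence.from #⇔<⊎> ∘ inj₁

  #⇒<⊎> : x # y → x < y ⊎ y < x
  #⇒<⊎> = Equivalence.to #⇔<⊎>

  -- The substitute for trichotomy: cotransitivity separates `z` from `x` or from `y`, and when the
  -- separation points the wrong way, transitivity with `x < y` gives the other alternative.
  <-weaklyLinear : x < y → ∀ z → x < z ⊎ z < y
  <-weaklyLinear x<y z with #-cotrans (<⇒# x<y) z
  ... | inj₁ x#z = [ inj₁ , (λ z<x → inj₂ (<-trans z<x x<y)) ]′ (#⇒<⊎> x#z)
  ... | inj₂ z#y = [ inj₂ , (λ y<z → inj₁ (<-trans x<y y<z)) ]′ (#⇒<⊎> z#y)

  <⇒≤ : x < y → x ≤ y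
  <⇒≤ = <-asym

  ≤-reflexive : x ≈ y → x ≤ y
  ≤-reflexive x≈y = <-irrefl (sym x≈y)

  <-≤-trans : x < y → y ≤ z → x < z
  <-≤-trans {z = z} x<y y≤z = [ (λ x<z → x<z) , (λ z<y → contradiction z<y y≤z) ]′ (<-weaklyLinear x<y z)

  ≤-<-trans : x ≤ y → y < z → x < z
  ≤-<-trans {x = x} x≤y y<z = [ (λ y<x → contradiction y<x x≤y) , (λ x<z → x<z) ]′ (<-weaklyLinear y<z x)

  ≤-trans : x ≤ y → y ≤ z → x ≤ z
  ≤-trans x≤y y≤z z<x = y≤z (<-≤-trans z<x x≤y)

  ≤-antisym : x ≤ y → y ≤ x → x ≈ y
  ≤-antisym x≤y y≤x = proj₁ (tight _ _) ([ y≤x , x≤y ]′ ∘ #⇒<⊎>)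

  ≤-isPreorder : IsPreorder _≈_ _≤_
  ≤-isPreorder = record
    { isEquivalence = isEquivalence
    ; reflexive     = ≤-reflexive
    ; trans         = ≤-trans
    }

  module ≤-Reasoning = TripleReasoning
    ≤-isPreorder <-asym <-trans <-resp-≈ <⇒≤ <-≤-trans ≤-<-trans

  -- The sign of x is undecidable, but ≤ is a negated <.
  ≤-signCases : ∀ x → (0# ≤ x → z ≤ w) → (x ≤ 0# → z ≤ w) → z ≤ w
  ≤-signCases x nonneg nonpos w<z = nonneg (λ x<0 → nonpos (<⇒≤ x<0) w<z) w<z

  +-cancelʳ-< : ∀ z → x + z < y + z → x < y
  +-cancelʳ-< {x} {y} z x+z<y+z =
    <-respˡ (cancel x z) (<-respʳ (cancel y z) (+-monoˡ-< (- z) x+z<y+z))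
    where
    cancel : ∀ x z → x + z - z ≈ x
    cancel = solve 2 (λ x z → x :+ z :- z := x) refl

  +-monoˡ-≤ : ∀ z → x ≤ y → x + z ≤ y + z
  +-monoˡ-≤ z x≤y = x≤y ∘ +-cancelʳ-< z

  +-monoʳ-≤ : ∀ z → x ≤ y → z + x ≤ z + y
  +-monoʳ-≤ z x≤y = x≤y ∘ +-cancelʳ-< z ∘ <-respˡ (+-comm _ _) ∘ <-respʳ (+-comm _ _)

  +-mono-≤ : x ≤ y → z ≤ w → x + z ≤ y + w
  +-mono-≤ {x} {y} {z} {w} x≤y z≤w = begin
    x + z  ≤⟨ +-monoˡ-≤ z x≤y ⟩
    y + z  ≈⟨ +-comm y z ⟩
    z + y  ≤⟨ +-monoˡ-≤ y z≤w ⟩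
    w + y  ≈⟨ +-comm w y ⟩
    y + w  ∎
    where open ≤-Reasoning

  x<y⇒0<y-x : x < y → 0# < y - x
  x<y⇒0<y-x {x} x<y = <-respˡ (-‿inverseʳ x) (+-monoˡ-< (- x) x<y)

  0<y-x⇒x<y : 0# < y - x → x < y
  0<y-x⇒x<y {y} {x} 0<y-x = +-cancelʳ-< (- x) (<-respˡ (sym (-‿inverseʳ x)) 0<y-x)

  x≤y⇒0≤y-x : x ≤ y → 0# ≤ y - x
  x≤y⇒0≤y-x {x} {y} x≤y y-x<0 =
    x≤y (+-cancelʳ-< (- x) (<-respʳ (sym (-‿inverseʳ x)) y-x<0))

  0≤y-x⇒x≤y : 0# ≤ y - x → x ≤ y
  0≤y-x⇒x≤y {y} {x} 0≤y-x y<x =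
    0≤y-x (<-respʳ (-‿inverseʳ x) (+-monoˡ-< (- x) y<x))

  x-y≤x : 0# ≤ y → x - y ≤ x
  x-y≤x {y} {x} 0≤y = 0≤y-x⇒x≤y (≤-trans 0≤y
    (≤-reflexive (solve 2 (λ x y → y := x :- (x :- y)) refl x y)))

  -‿anti-mono-< : x < y → - y < - x
  -‿anti-mono-< {x} {y} x<y = 0<y-x⇒x<y (<-respʳ (swap x y) (x<y⇒0<y-x x<y))
    where
    swap : ∀ x y → y - x ≈ - x - (- y)
    swap = solve 2 (λ x y → y :- x := :- x :- (:- y)) refl

  -‿anti-mono-≤ : x ≤ y → - y ≤ - x
  -‿anti-mono-≤ x≤y -x<-y =
    x≤y (<-respˡ (-‿involutive _) (<-respʳ (-‿involutive _) (-‿anti-mono-< -x<-y)))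

  x<0⇒0<-x : x < 0# → 0# < - x
  x<0⇒0<-x = <-respˡ -0#≈0# ∘ -‿anti-mono-<

  x≤0⇒0≤-x : x ≤ 0# → 0# ≤ - x
  x≤0⇒0≤-x x≤0 -x<0 = x≤0 (<-respʳ (-‿involutive _) (x<0⇒0<-x -x<0))

  0≤x⇒-x≤0 : 0# ≤ x → - x ≤ 0#
  0≤x⇒-x≤0 0≤x 0<-x = 0≤x (<-respˡ (-‿involutive _) (<-respʳ -0#≈0# (-‿anti-mono-< 0<-x)))

  *-monoˡ-< : 0# < z → x < y → z * x < z * y
  *-monoˡ-< {z} {x} {y} 0<z x<y =
    0<y-x⇒x<y (<-respʳ (x[y-z]≈xy-xz z y x) (*-pos 0<z (x<y⇒0<y-x x<y)))

  *-cancelˡ-≤ : 0# < z → z * x ≤ z * y → x ≤ y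
  *-cancelˡ-≤ 0<z zx≤zy = zx≤zy ∘ *-monoˡ-< 0<z

  0<1 : 0# < 1#
  0<1 = [ (λ 1<0 → contradiction (0<1′ 1<0) (<⇒≤ 1<0)) , (λ 0<1 → 0<1) ]′ (#⇒<⊎> 1#0)
    where
    0<1′ : 1# < 0# → 0# < 1#
    0<1′ 1<0 = <-respʳ (solve 0 (:- con 1ℤ :* :- con 1ℤ := con 1ℤ) refl)
      (*-pos (x<0⇒0<-x 1<0) (x<0⇒0<-x 1<0))

  #0⇒rightInverse : (x#0 : x # 0#) → x * proj₁ (#⇒invertible x#0) ≈ 1#
  #0⇒rightInverse {x} x#0 = trans (*-congʳ (sym (x-0≈x x))) (proj₂ (proj₂ (#⇒invertible x#0)))

  -- Every later quotient is handled through this equation alone, so the chosen inverse never enters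
  -- a computation.
  y*[x/y]≈x : (y#0 : y # 0#) → y * (x / y [ y#0 ]) ≈ x
  y*[x/y]≈x {y} {x} y#0 = begin
    y * (x * y⁻¹)  ≈⟨ solve 3 (λ x y z → y :* (x :* z) := x :* (y :* z)) refl x y y⁻¹ ⟩
    x * (y * y⁻¹)  ≈⟨ *-congˡ (#0⇒rightInverse y#0) ⟩
    x * 1#         ≈⟨ *-identityʳ x ⟩
    x              ∎
    where
    open SetoidReasoning setoid
    y⁻¹ : Carrier
    y⁻¹ = proj₁ (#⇒invertible y#0)

  *-cancelˡ-# : z # 0# → z * x ≈ z * y → x ≈ y
  *-cancelˡ-# {z} {x} {y} z#0 zx≈zy = begin
    x              ≈⟨ restore x ⟩
    z⁻¹ * (z * x)  ≈⟨ *-congˡ zx≈zy ⟩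
    z⁻¹ * (z * y)  ≈⟨ restore y ⟨
    y              ∎
    where
    open SetoidReasoning setoid
    z⁻¹ : Carrier
    z⁻¹ = proj₁ (#⇒invertible z#0)
    restore : ∀ x → x ≈ z⁻¹ * (z * x)
    restore x = begin
      x              ≈⟨ *-identityˡ x ⟨
      1# * x         ≈⟨ *-congʳ (#0⇒rightInverse z#0) ⟨
      z * z⁻¹ * x    ≈⟨ solve 3 (λ x z z⁻¹ → z :* z⁻¹ :* x := z⁻¹ :* (z :* x)) refl x z z⁻¹ ⟩
      z⁻¹ * (z * x)  ∎

  xy#0⇒x#0 : x * y # 0# → x # 0#
  xy#0⇒x#0 {x} {y} xy#0 = invertibleˡ⇒# (y * xy⁻¹ , (begin
    y * xy⁻¹ * (x - 0#)  ≈⟨ *-congˡ (x-0≈x x) ⟩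
    y * xy⁻¹ * x         ≈⟨ solve 3 (λ x y z → y :* z :* x := x :* y :* z) refl x y xy⁻¹ ⟩
    x * y * xy⁻¹         ≈⟨ #0⇒rightInverse xy#0 ⟩
    1#                   ∎))
    where
    open SetoidReasoning setoid
    xy⁻¹ : Carrier
    xy⁻¹ = proj₁ (#⇒invertible xy#0)

  xy#0⇒y#0 : x * y # 0# → y # 0#
  xy#0⇒y#0 xy#0 = xy#0⇒x#0 (#-congʳ (*-comm _ _) xy#0)

  0≤x∧x#0⇒0<x : 0# ≤ x → x # 0# → 0# < x
  0≤x∧x#0⇒0<x 0≤x x#0 = [ (λ x<0 → contradiction x<0 0≤x) , (λ 0<x → 0<x) ]′ (#⇒<⊎> x#0)

  -- The goal is a negation, so `x * y < 0#` may be assumed. Then the product, hence each factor, is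
  -- apart from zero; both factors are strictly positive and so is their product.
  *-nonNeg : 0# ≤ x → 0# ≤ y → 0# ≤ x * y
  *-nonNeg 0≤x 0≤y xy<0 = <-asym xy<0
    (*-pos (0≤x∧x#0⇒0<x 0≤x (xy#0⇒x#0 xy#0)) (0≤x∧x#0⇒0<x 0≤y (xy#0⇒y#0 xy#0)))
    where
    xy#0 = <⇒# xy<0

  *-monoˡ-≤ : 0# ≤ z → x ≤ y → z * x ≤ z * y
  *-monoˡ-≤ {z} {x} {y} 0≤z x≤y = 0≤y-x⇒x≤y (≤-trans (*-nonNeg 0≤z (x≤y⇒0≤y-x x≤y))
    (≤-reflexive (x[y-z]≈xy-xz z y x)))

  -- Cancellation for `≤` yields only `0# ≤ y - x`. The missing strictness comes from the apartness
  -- of `z * (y - x)` from zero, which passes to its factor `y - x`.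
  *-cancelˡ-< : 0# < z → z * x < z * y → x < y
  *-cancelˡ-< {z} {x} {y} 0<z zx<zy = 0<y-x⇒x<y (0≤x∧x#0⇒0<x
    (x≤y⇒0≤y-x (*-cancelˡ-≤ 0<z (<⇒≤ zx<zy)))
    (xy#0⇒y#0 (#-congʳ (sym (x[y-z]≈xy-xz z y x))
      (#-sym (<⇒# (x<y⇒0<y-x zx<zy))))))

  -- `⊔` is specified through `≤` alone, so the alternative is found by weak linearity at `y` and at
  -- `z`. The remaining case, both strictly below `y ⊔ z`, is absurd: it forces `z ≤ y`, and then
  -- `y` is an upper bound.
  <⊔⇒<⊎< : x < y ⊔ z → x < y ⊎ x < z
  <⊔⇒<⊎< {x} {y} {z} x<y⊔z with <-weaklyLinear x<y⊔z y | <-weaklyLinear x<y⊔z z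
  ... | inj₁ x<y   | _          = inj₁ x<y
  ... | inj₂ _     | inj₁ x<z   = inj₂ x<z
  ... | inj₂ y<y⊔z | inj₂ z<y⊔z = contradiction y<y⊔z
    (proj₂ (proj₂ (supremum y z)) y (≤-reflexive refl) z≤y)
    where
    z≤y : z ≤ y
    z≤y y<z = proj₂ (proj₂ (supremum y z)) z (<⇒≤ y<z) (≤-reflexive refl) z<y⊔z

  x≤∣x∣ : ∀ x → x ≤ ∣ x ∣
  x≤∣x∣ x = proj₁ (supremum x (- x))

  -x≤∣x∣ : ∀ x → - x ≤ ∣ x ∣
  -x≤∣x∣ x = proj₁ (proj₂ (supremum x (- x)))

  ∣∣-least : x ≤ y → - x ≤ y → ∣ x ∣ ≤ y
  ∣∣-least {x} {y} = proj₂ (proj₂ (supremum x (- x))) y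

  0≤x⇒∣x∣≈x : 0# ≤ x → ∣ x ∣ ≈ x
  0≤x⇒∣x∣≈x {x} 0≤x =
    ≤-antisym (∣∣-least (≤-reflexive refl) (≤-trans (0≤x⇒-x≤0 0≤x) 0≤x)) (x≤∣x∣ x)

  ∣∣-cong : x ≈ y → ∣ x ∣ ≈ ∣ y ∣
  ∣∣-cong {x} {y} x≈y = ≤-antisym (mono x≈y) (mono (sym x≈y))
    where
    mono : ∀ {x y} → x ≈ y → ∣ x ∣ ≤ ∣ y ∣
    mono x≈y = ∣∣-least (≤-trans (≤-reflexive x≈y) (x≤∣x∣ _))
      (≤-trans (≤-reflexive (-‿cong x≈y)) (-x≤∣x∣ _))

  ∣-x∣≈∣x∣ : ∀ x → ∣ - x ∣ ≈ ∣ x ∣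
  ∣-x∣≈∣x∣ x = ≤-antisym (mono x) (≤-trans (≤-reflexive (∣∣-cong (sym (-‿involutive x)))) (mono (- x)))
    where
    mono : ∀ x → ∣ - x ∣ ≤ ∣ x ∣
    mono x = ∣∣-least (-x≤∣x∣ x) (≤-trans (≤-reflexive (-‿involutive x)) (x≤∣x∣ x))

  0≤∣x∣ : ∀ x → 0# ≤ ∣ x ∣
  0≤∣x∣ x = ≤-signCases x (λ 0≤x → ≤-trans 0≤x (x≤∣x∣ x))
    (λ x≤0 → ≤-trans (x≤0⇒0≤-x x≤0) (-x≤∣x∣ x))

  x#0⇒0<∣x∣ : x # 0# → 0# < ∣ x ∣
  x#0⇒0<∣x∣ {x} x#0 = [ (λ x<0 → <-≤-trans (x<0⇒0<-x x<0) (-x≤∣x∣ x)) , (λ 0<x → <-≤-trans 0<x (x≤∣x∣ x)) ]′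
    (#⇒<⊎> x#0)

  ∣x+y∣≤∣x∣+∣y∣ : ∀ x y → ∣ x + y ∣ ≤ ∣ x ∣ + ∣ y ∣
  ∣x+y∣≤∣x∣+∣y∣ x y = ∣∣-least (+-mono-≤ (x≤∣x∣ x) (x≤∣x∣ y))
    (≤-trans (≤-reflexive (solve 2 (λ x y → :- (x :+ y) := :- x :+ :- y) refl x y))
      (+-mono-≤ (-x≤∣x∣ x) (-x≤∣x∣ y)))

  -- Sign cases are available only for a goal `≤`. So `byCases` passes the equation found in each
  -- case to a continuation that weakens it to an inequality, once for each direction.
  ∣x*y∣≈∣x∣*∣y∣ : ∀ x y → ∣ x * y ∣ ≈ ∣ x ∣ * ∣ y ∣
  ∣x*y∣≈∣x∣*∣y∣ x y = ≤-antisym (byCases ≤-reflexive) (byCases (≤-reflexive ∘ sym))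
    where
    nonNeg-nonNeg : ∀ {x y} → 0# ≤ x → 0# ≤ y → ∣ x * y ∣ ≈ ∣ x ∣ * ∣ y ∣
    nonNeg-nonNeg 0≤x 0≤y = trans (0≤x⇒∣x∣≈x (*-nonNeg 0≤x 0≤y))
      (sym (*-cong (0≤x⇒∣x∣≈x 0≤x) (0≤x⇒∣x∣≈x 0≤y)))

    negateʳ : ∀ {x y} → ∣ x * - y ∣ ≈ ∣ x ∣ * ∣ - y ∣ → ∣ x * y ∣ ≈ ∣ x ∣ * ∣ y ∣
    negateʳ {x} {y} eq = trans (sym (∣-x∣≈∣x∣ (x * y)))
      (trans (∣∣-cong (solve 2 (λ x y → :- (x :* y) := x :* :- y) refl x y)) (trans eq (*-congˡ (∣-x∣≈∣x∣ y))))

    negateˡ : ∀ {x y} → ∣ - x * y ∣ ≈ ∣ - x ∣ * ∣ y ∣ → ∣ x * y ∣ ≈ ∣ x ∣ * ∣ y ∣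
    negateˡ {x} {y} eq = trans (∣∣-cong (*-comm x y))
      (trans (negateʳ (trans (∣∣-cong (*-comm y (- x))) (trans eq (*-comm _ _)))) (*-comm _ _))

    byCases : ∀ {z w} → (∣ x * y ∣ ≈ ∣ x ∣ * ∣ y ∣ → z ≤ w) → z ≤ w
    byCases k = ≤-signCases x
      (λ 0≤x → ≤-signCases y
        (λ 0≤y → k (nonNeg-nonNeg 0≤x 0≤y))
        (λ y≤0 → k (negateʳ (nonNeg-nonNeg 0≤x (x≤0⇒0≤-x y≤0)))))
      (λ x≤0 → ≤-signCases y
        (λ 0≤y → k (negateˡ (nonNeg-nonNeg (x≤0⇒0≤-x x≤0) 0≤y)))
        (λ y≤0 → k (negateˡ (negateʳ (nonNeg-nonNeg (x≤0⇒0≤-x x≤0) (x≤0⇒0≤-x y≤0))))))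

  ∣x-y∣≈∣y-x∣ : ∀ x y → ∣ x - y ∣ ≈ ∣ y - x ∣
  ∣x-y∣≈∣y-x∣ x y = trans (sym (∣-x∣≈∣x∣ (x - y)))
    (∣∣-cong (solve 2 (λ x y → :- (x :- y) := y :- x) refl x y))

-- Powers, a Cauchy criterion by telescoping, and series summed in pairs.

module Sequences {c ℓ₁ ℓ₂} (F : OrderedField c ℓ₁ ℓ₂) where
  open OrderedField F
  open OrderedFieldProperties F
  open Exp semiring using (^-homo-*)

  1^n≈1 : ∀ n → 1# ^ n ≈ 1#
  1^n≈1 zero    = refl
  1^n≈1 (suc n) = trans (*-identityˡ _) (1^n≈1 n)

  ∣1∣≈1 : ∣ 1# ∣ ≈ 1#
  ∣1∣≈1 = 0≤x⇒∣x∣≈x (<⇒≤ 0<1)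

  ∣x^n∣≈∣x∣^n : ∀ x n → ∣ x ^ n ∣ ≈ ∣ x ∣ ^ n
  ∣x^n∣≈∣x∣^n x zero    = ∣1∣≈1
  ∣x^n∣≈∣x∣^n x (suc n) = trans (∣x*y∣≈∣x∣*∣y∣ x (x ^ n)) (*-congˡ (∣x^n∣≈∣x∣^n x n))

  ∣[-1]^n∣≈1 : ∀ n → ∣ (- 1#) ^ n ∣ ≈ 1#
  ∣[-1]^n∣≈1 n = trans (∣x^n∣≈∣x∣^n (- 1#) n)
    (trans (Exp.^-congˡ semiring n (trans (∣-x∣≈∣x∣ 1#) ∣1∣≈1)) (1^n≈1 n))

  ∣[-1]^n*x∣≈∣x∣ : ∀ n x → ∣ (- 1#) ^ n * x ∣ ≈ ∣ x ∣
  ∣[-1]^n*x∣≈∣x∣ n x = trans (∣x*y∣≈∣x∣*∣y∣ _ x) (trans (*-congʳ (∣[-1]^n∣≈1 n)) (*-identityˡ _))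

  [-1]^[2n]≈1 : ∀ n → (- 1#) ^ (2 *ⁿ n) ≈ 1#
  [-1]^[2n]≈1 n = trans (sym (Exp.^-assocʳ semiring (- 1#) 2 n))
    (trans (Exp.^-congˡ semiring n (solve 0 (:- con 1ℤ :* (:- con 1ℤ :* con 1ℤ) := con 1ℤ) refl)) (1^n≈1 n))

  [-1]^[2n∸1]≈-1 : ∀ n .{{_ : NonZero n}} → (- 1#) ^ (2 *ⁿ n ∸ 1) ≈ - 1#
  [-1]^[2n∸1]≈-1 n@(suc _) = begin
    -- Since `n` is a successor, one further factor `- 1#` turns the exponent into `2 *ⁿ n` by
    -- definition.
    (- 1#) ^ (2 *ⁿ n ∸ 1)                    ≈⟨ solve 1 (λ x → x := :- con 1ℤ :* (:- con 1ℤ :* x)) refl _ ⟩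
    - 1# * (- 1#) ^ (2 *ⁿ n)                 ≈⟨ *-congˡ ([-1]^[2n]≈1 n) ⟩
    - 1# * 1#                                ≈⟨ *-identityʳ _ ⟩
    - 1#                                     ∎
    where open SetoidReasoning setoid

  ^-#0 : ∀ {x} → x # 0# → ∀ n → x ^ n # 0#
  ^-#0 x#0 zero    = 1#0
  ^-#0 x#0 (suc n) = x#0y#0→xy#0 x#0 (^-#0 x#0 n)

  ^-pos : ∀ {x} → 0# < x → ∀ n → 0# < x ^ n
  ^-pos 0<x zero    = 0<1
  ^-pos 0<x (suc n) = *-pos 0<x (^-pos 0<x n)

  x^n≤1 : ∀ {x} → 0# < x → x ≤ 1# → ∀ n → x ^ n ≤ 1#
  x^n≤1 0<x x≤1 zero    = ≤-reflexive refl
  x^n≤1 {x} 0<x x≤1 (suc n) = begin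
    x * x ^ n  ≤⟨ *-monoˡ-≤ (<⇒≤ 0<x) (x^n≤1 0<x x≤1 n) ⟩
    x * 1#     ≈⟨ *-identityʳ x ⟩
    x          ≤⟨ x≤1 ⟩
    1#         ∎
    where open ≤-Reasoning

  ^-antitone : ∀ {x m n} → 0# < x → x ≤ 1# → m ℕ.≤ n → x ^ n ≤ x ^ m
  ^-antitone {x} {m} {n} 0<x x≤1 m≤n = begin
    x ^ n                  ≡⟨ ≡.cong (x ^_) (ℕ.m+[n∸m]≡n m≤n) ⟨
    x ^ (m ℕ.+ (n ∸ m))    ≈⟨ ^-homo-* x m (n ∸ m) ⟩
    x ^ m * x ^ (n ∸ m)    ≤⟨ *-monoˡ-≤ (<⇒≤ (^-pos 0<x m)) (x^n≤1 0<x x≤1 (n ∸ m)) ⟩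
    x ^ m * 1#             ≈⟨ *-identityʳ _ ⟩
    x ^ m                  ∎
    where open ≤-Reasoning

  0≤n·1 : ∀ n → 0# ≤ n · 1#
  0≤n·1 zero    = ≤-reflexive refl
  0≤n·1 (suc n) = ≤-trans (≤-reflexive (sym (+-identityˡ 0#))) (+-mono-≤ (<⇒≤ 0<1) (0≤n·1 n))

  -- Bernoulli's inequality for `1 / r`, weakened by `1 / r - 1 ≥ 1 - r` and cleared of division. In
  -- the inductive step, writing `h = 1 - r`, the product `(1 - h)(1 + (n + 1) h)` falls short of
  -- `1 + n h` by `(n + 1) h²`.
  bernoulli : ∀ {r} → 0# < r → r ≤ 1# → ∀ n → r ^ n * (1# + n · 1# * (1# - r)) ≤ 1#
  bernoulli {r} 0<r r≤1 zero = ≤-reflexive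
    (solve 1 (λ r → con 1ℤ :* (con 1ℤ :+ con 0ℤ :* (con 1ℤ :- r)) := con 1ℤ) refl r)
  bernoulli {r} 0<r r≤1 (suc n) = begin
    r * r ^ n * (1# + (1# + n · 1#) * (1# - r))
      ≈⟨ solve 3 (λ r p N → r :* p :* (con 1ℤ :+ (con 1ℤ :+ N) :* (con 1ℤ :- r)) :=
                   p :* (con 1ℤ :+ N :* (con 1ℤ :- r) :- (con 1ℤ :+ N) :* ((con 1ℤ :- r) :* (con 1ℤ :- r))))
           refl r (r ^ n) (n · 1#) ⟩
    r ^ n * (1# + n · 1# * (1# - r) - (1# + n · 1#) * ((1# - r) * (1# - r)))
      ≤⟨ *-monoˡ-≤ (<⇒≤ (^-pos 0<r n)) (x-y≤x (*-nonNeg (0≤n·1 (suc n)) (*-nonNeg 0≤1-r 0≤1-r))) ⟩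
    r ^ n * (1# + n · 1# * (1# - r))
      ≤⟨ bernoulli 0<r r≤1 n ⟩
    1# ∎
    where
    open ≤-Reasoning
    0≤1-r : 0# ≤ 1# - r
    0≤1-r = x≤y⇒0≤y-x r≤1

  -- Summing the steps leaves `b n - b m`, which is at most `b n`. This sum also shows that `b`
  -- decreases, so smallness at a single index suffices. The factor `g` stands for a denominator
  -- that is never divided out; hence the index is chosen for `g * ε`.
  isCauchy-telescoping : ∀ (s b : ℕ → Carrier) {g} → 0# < g →
    (∀ n → g * ∣ s (suc n) - s n ∣ ≤ b n - b (suc n)) → (∀ n → 0# ≤ b n) →
    (∀ ε → 0# < ε → ∃[ N ] b N < ε) → IsCauchy s
  isCauchy-telescoping s b {g} 0<g step 0≤b b-small ε 0<ε = N , λ m n N≤m N≤n →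
    [ (λ m≤n → <-respˡ (∣x-y∣≈∣y-x∣ (s n) (s m)) (close N≤m m≤n)) , close N≤n ]′ (ℕ.≤-total m n)
    where
    N : ℕ
    N = proj₁ (b-small (g * ε) (*-pos 0<g 0<ε))

    open ≤-Reasoning

    bound′ : ∀ n k → g * ∣ s (k ℕ.+ n) - s n ∣ ≤ b n - b (k ℕ.+ n)
    bound′ n zero = begin
      g * ∣ s n - s n ∣  ≈⟨ *-congˡ (∣∣-cong (-‿inverseʳ (s n))) ⟩
      g * ∣ 0# ∣         ≈⟨ *-congˡ (0≤x⇒∣x∣≈x (≤-reflexive refl)) ⟩
      g * 0#             ≈⟨ zeroʳ g ⟩
      0#                 ≈⟨ -‿inverseʳ (b n) ⟨
      b n - b n          ∎
    bound′ n (suc k) = begin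
      g * ∣ s″ - s n ∣
        ≈⟨ *-congˡ (∣∣-cong (solve 3 (λ x y z → x :- z := (x :- y) :+ (y :- z)) refl s″ s′ (s n))) ⟩
      g * ∣ (s″ - s′) + (s′ - s n) ∣
        ≤⟨ *-monoˡ-≤ (<⇒≤ 0<g) (∣x+y∣≤∣x∣+∣y∣ _ _) ⟩
      g * (∣ s″ - s′ ∣ + ∣ s′ - s n ∣)
        ≈⟨ distribˡ g _ _ ⟩
      g * ∣ s″ - s′ ∣ + g * ∣ s′ - s n ∣
        ≤⟨ +-mono-≤ (step (k ℕ.+ n)) (bound′ n k) ⟩
      (b (k ℕ.+ n) - b (suc k ℕ.+ n)) + (b n - b (k ℕ.+ n))
        ≈⟨ solve 3 (λ x y z → (y :- x) :+ (z :- y) := z :- x) refl (b (suc k ℕ.+ n)) (b (k ℕ.+ n)) (b n) ⟩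
      b n - b (suc k ℕ.+ n) ∎
      where
      s′ s″ : Carrier
      s′ = s (k ℕ.+ n)
      s″ = s (suc k ℕ.+ n)

    bound : ∀ {m n} → n ℕ.≤ m → g * ∣ s m - s n ∣ ≤ b n - b m
    bound {m} {n} n≤m =
      ≡.subst (λ m → g * ∣ s m - s n ∣ ≤ b n - b m) (ℕ.m∸n+n≡m n≤m) (bound′ n (m ∸ n))

    b-antitone : ∀ {m n} → n ℕ.≤ m → b m ≤ b n
    b-antitone n≤m = 0≤y-x⇒x≤y (≤-trans (*-nonNeg (<⇒≤ 0<g) (0≤∣x∣ _)) (bound n≤m))

    close : ∀ {m n} → N ℕ.≤ n → n ℕ.≤ m → ∣ s m - s n ∣ < ε
    close {m} {n} N≤n n≤m = *-cancelˡ-< 0<g (begin-strict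
      g * ∣ s m - s n ∣  ≤⟨ bound n≤m ⟩
      b n - b m          ≤⟨ x-y≤x (0≤b m) ⟩
      b n                ≤⟨ b-antitone N≤n ⟩
      b N                <⟨ proj₂ (b-small (g * ε) (*-pos 0<g 0<ε)) ⟩
      g * ε              ∎)

  -- `partialSum` unfolds only at a visible successor, whereas `2 *ⁿ suc n ∸ 1` reduces to a sum
  -- that is stuck on `n`.
  partialSum-last : ∀ (f : (n : ℕ) → .{{NonZero n}} → Carrier) n .{{_ : NonZero n}} →
    partialSum f n ≡ partialSum f (n ∸ 1) + f n
  partialSum-last f (suc n) = ≡.refl

  partialSum-pairs : ∀ (f g : (n : ℕ) → .{{NonZero n}} → Carrier) →
    (∀ n .{{_ : NonZero n}} → g n ≈ - (f (2 *ⁿ n ∸ 1) {{2n∸1≢0 n}} + f (2 *ⁿ n) {{2n≢0 n}})) →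
    ∀ n → partialSum g n ≈ - partialSum f (2 *ⁿ n)
  partialSum-pairs f g pair zero    = sym -0#≈0#
  partialSum-pairs f g pair (suc n) = begin
    partialSum g n + g (suc n)
      ≈⟨ +-cong (partialSum-pairs f g pair n) (pair (suc n)) ⟩
    - partialSum f (2 *ⁿ n) + - (f₁ + f₂)
      ≈⟨ solve 3 (λ x y z → :- x :+ :- (y :+ z) := :- (x :+ y :+ z)) refl _ _ _ ⟩
    - (partialSum f (2 *ⁿ n) + f₁ + f₂)
      ≡⟨ ≡.cong (λ k → - (partialSum f k + f₁ + f₂)) (≡.cong (_∸ 1) (ℕ.+-suc n (n ℕ.+ 0))) ⟨
    - (partialSum f (2 *ⁿ suc n ∸ 1 ∸ 1) + f₁ + f₂)
      ≡⟨ ≡.cong (λ x → - (x + f₂)) (partialSum-last f (2 *ⁿ suc n ∸ 1) {{2n∸1≢0 (suc n)}}) ⟨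
    - partialSum f (2 *ⁿ suc n) ∎
    where
    open SetoidReasoning setoid
    f₁ f₂ : Carrier
    f₁ = f (2 *ⁿ suc n ∸ 1) {{2n∸1≢0 (suc n)}}
    f₂ = f (2 *ⁿ suc n)

  -- The partial sums of `g` are, up to sign, a subsequence of those of `f`; as `n ≤ 2n`, the
  -- threshold for `f` also serves for `g`.
  hasSum-pairs : ∀ (f g : (n : ℕ) → .{{NonZero n}} → Carrier) {S} →
    (∀ n .{{_ : NonZero n}} → g n ≈ - (f (2 *ⁿ n ∸ 1) {{2n∸1≢0 n}} + f (2 *ⁿ n) {{2n≢0 n}})) →
    HasSum f S → HasSum g (- S)
  hasSum-pairs f g {S} pair f⟶S ε 0<ε = proj₁ (f⟶S ε 0<ε) , λ n N≤n → begin-strict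
    ∣ partialSum g n - (- S) ∣              ≈⟨ ∣∣-cong (+-congʳ (partialSum-pairs f g pair n)) ⟩
    ∣ - partialSum f (2 *ⁿ n) - (- S) ∣     ≈⟨ ∣∣-cong (solve 2 (λ x y → :- x :- :- y := :- (x :- y)) refl _ S) ⟩
    ∣ - (partialSum f (2 *ⁿ n) - S) ∣       ≈⟨ ∣-x∣≈∣x∣ _ ⟩
    ∣ partialSum f (2 *ⁿ n) - S ∣           <⟨ proj₂ (f⟶S ε 0<ε) (2 *ⁿ n) (ℕ.≤-trans N≤n (ℕ.m≤m+n n _)) ⟩
    ε                                       ∎
    where open ≤-Reasoning

-- Convergence by comparison with a geometric series.

module RealSeries {c ℓ₁ ℓ₂} (ℝ : RealNumbers c ℓ₁ ℓ₂) where
  open RealNumbers ℝ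
  open OrderedFieldProperties orderedField
  open Sequences orderedField

  archimedean-* : ∀ x {e} → 0# < e → ∃[ n ] x < n · 1# * e
  archimedean-* x {e} 0<e with archimedean (x / e [ #-sym (<⇒# 0<e) ])
  ... | n , x/e<n = n , (begin-strict
    x                                 ≈⟨ y*[x/y]≈x (#-sym (<⇒# 0<e)) ⟨
    e * (x / e [ #-sym (<⇒# 0<e) ])   <⟨ *-monoˡ-< 0<e x/e<n ⟩
    e * n · 1#                        ≈⟨ *-comm e _ ⟩
    n · 1# * e                        ∎)
    where open ≤-Reasoning

  -- Bernoulli gives `r ^ N * N * (1 - r) ≤ 1`, so it is enough to take `N` with
  -- `x < N * (1 - r) * ε`.
  geometric-small : ∀ {r} x → 0# < r → r < 1# → ∀ ε → 0# < ε → ∃[ N ] x * r ^ N < ε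
  geometric-small {r} x 0<r r<1 ε 0<ε with archimedean-* x (*-pos (x<y⇒0<y-x r<1) 0<ε)
  ... | N , x<N[1-r]ε = N , (begin-strict
    x * r ^ N
      ≈⟨ *-comm x _ ⟩
    r ^ N * x
      <⟨ *-monoˡ-< (^-pos 0<r N) x<N[1-r]ε ⟩
    r ^ N * (N · 1# * ((1# - r) * ε))
      ≈⟨ solve 4 (λ p N h ε → p :* (N :* (h :* ε)) := ε :* (p :* (con 1ℤ :+ N :* h) :- p))
           refl (r ^ N) (N · 1#) (1# - r) ε ⟩
    ε * (r ^ N * (1# + N · 1# * (1# - r)) - r ^ N)
      ≤⟨ *-monoˡ-≤ (<⇒≤ 0<ε) (≤-trans (x-y≤x (<⇒≤ (^-pos 0<r N))) (bernoulli 0<r (<⇒≤ r<1) N)) ⟩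
    ε * 1#
      ≈⟨ *-identityʳ ε ⟩
    ε ∎)
    where open ≤-Reasoning

  -- With `b n = x * r ^ n`, the difference `b n - b (suc n)` is `(1 - r) * b n`. This costs a
  -- second factor `1 - r` beside the one in the hypothesis, whence the choice of `g` as its square.
  hasSum-geometricBound : ∀ (f : (n : ℕ) → .{{NonZero n}} → Carrier) x {r} → 0# ≤ x → 0# < r → r < 1# →
    (∀ n .{{_ : NonZero n}} → (1# - r) * ∣ f n ∣ ≤ x * r ^ n) → ∃[ S ] HasSum f S
  hasSum-geometricBound f x {r} 0≤x 0<r r<1 bound = complete (partialSum f)
    (isCauchy-telescoping (partialSum f) (λ n → x * r ^ n) (*-pos 0<1-r 0<1-r) step
      (λ n → *-nonNeg 0≤x (<⇒≤ (^-pos 0<r n))) (geometric-small x 0<r r<1))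
    where
    open ≤-Reasoning

    0<1-r : 0# < 1# - r
    0<1-r = x<y⇒0<y-x r<1

    step : ∀ n → (1# - r) * (1# - r) * ∣ partialSum f (suc n) - partialSum f n ∣ ≤ x * r ^ n - x * r ^ suc n
    step n = begin
      (1# - r) * (1# - r) * ∣ partialSum f n + f (suc n) - partialSum f n ∣
        ≈⟨ *-congˡ (∣∣-cong (solve 2 (λ s y → s :+ y :- s := y) refl (partialSum f n) (f (suc n)))) ⟩
      (1# - r) * (1# - r) * ∣ f (suc n) ∣
        ≈⟨ *-assoc _ _ _ ⟩
      (1# - r) * ((1# - r) * ∣ f (suc n) ∣)
        ≤⟨ *-monoˡ-≤ (<⇒≤ 0<1-r) (bound (suc n)) ⟩
      (1# - r) * (x * r ^ suc n)
        ≤⟨ *-monoˡ-≤ (<⇒≤ 0<1-r) (*-monoˡ-≤ 0≤x (^-antitone 0<r (<⇒≤ r<1) (ℕ.n≤1+n n))) ⟩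
      (1# - r) * (x * r ^ n)
        ≈⟨ solve 3 (λ x r p → (con 1ℤ :- r) :* (x :* p) := x :* p :- x :* (r :* p)) refl x r (r ^ n) ⟩
      x * r ^ n - x * r ^ suc n ∎

-- Vieta's and Binet's formulas, and the ratio of the two roots.

module DominantRoot {c ℓ₁ ℓ₂} (F : OrderedField c ℓ₁ ℓ₂) where
  open OrderedField F
  open OrderedFieldProperties F
  open Sequences F
  open CommutativeRing commutativeRing using (commutativeSemiring)
  open CommutativeExp commutativeSemiring using (^-distrib-*; ^-homo-*; ^-congˡ)

  -- Either `x` or `- x` exceeds `∣ y ∣`, which fixes the sign of `x - y`. Taking zero for `y`
  -- yields `α#0` as well.
  ∣y∣<∣x∣⇒x#y : ∀ {x y} → ∣ y ∣ < ∣ x ∣ → x - y # 0#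
  ∣y∣<∣x∣⇒x#y {x} {y} ∣y∣<∣x∣ with <⊔⇒<⊎< ∣y∣<∣x∣
  ... | inj₁ ∣y∣<x  = #-sym (<⇒# (x<y⇒0<y-x (≤-<-trans (x≤∣x∣ y) ∣y∣<x)))
  ... | inj₂ ∣y∣<-x = <⇒# (<-respˡ (-‿involutive _) (<-respʳ -0#≈0# (-‿anti-mono-< 0<-[x-y])))
    where
    0<-[x-y] : 0# < - (x - y)
    0<-[x-y] = <-respʳ (solve 2 (λ x y → :- x :- :- y := :- (x :- y)) refl x y)
      (x<y⇒0<y-x (≤-<-trans (-x≤∣x∣ y) ∣y∣<-x))

  module _ {P Q α β : Carrier}
    (α-root : α ^ 2 - P * α + Q ≈ 0#) (β-root : β ^ 2 - P * β + Q ≈ 0#)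
    (α-β#0 : α - β # 0#) where

    open SetoidReasoning setoid

    -- Subtracting the two root equations leaves a multiple of `α - β`, which cancels because the
    -- roots are apart.
    α+β≈P : α + β ≈ P
    α+β≈P = *-cancelˡ-# α-β#0 (begin
      (α - β) * (α + β)
        ≈⟨ solve 4 (λ P Q α β → (α :- β) :* (α :+ β) :=
             (α :* (α :* con 1ℤ) :- P :* α :+ Q) :- (β :* (β :* con 1ℤ) :- P :* β :+ Q) :+ (α :- β) :* P)
             refl P Q α β ⟩
      (α ^ 2 - P * α + Q) - (β ^ 2 - P * β + Q) + (α - β) * P
        ≈⟨ +-congʳ (+-cong α-root (-‿cong β-root)) ⟩
      0# - 0# + (α - β) * P
        ≈⟨ solve 1 (λ x → con 0ℤ :- con 0ℤ :+ x := x) refl _ ⟩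
      (α - β) * P ∎)

    αβ≈Q : α * β ≈ Q
    αβ≈Q = begin
      α * β                                            ≈⟨ solve 2 (λ α β → α :* β := (α :+ β) :* α :- α :* α :+ con 0ℤ) refl α β ⟩
      (α + β) * α - α * α + 0#                         ≈⟨ +-cong (+-congʳ (*-congʳ α+β≈P)) (sym α-root) ⟩
      P * α - α * α + (α ^ 2 - P * α + Q)
        ≈⟨ solve 3 (λ P Q α → P :* α :- α :* α :+ (α :* (α :* con 1ℤ) :- P :* α :+ Q) := Q) refl P Q α ⟩
      Q                                                ∎

    module _ {U : ℤ → Carrier} (lucas : IsLucasSequence P Q U) where
      open IsLucasSequence lucas

      binet-step : ∀ n {u v} → (α - β) * u ≈ α ^ n - β ^ n → (α - β) * v ≈ α ^ suc n - β ^ suc n →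
        (α - β) * (P * v - Q * u) ≈ α ^ suc (suc n) - β ^ suc (suc n)
      binet-step n {u} {v} eqᵤ eqᵥ = begin
        (α - β) * (P * v - Q * u)
          ≈⟨ *-congˡ (+-cong (*-congʳ α+β≈P) (-‿cong (*-congʳ αβ≈Q))) ⟨
        (α - β) * ((α + β) * v - α * β * u)
          ≈⟨ solve 4 (λ α β u v → (α :- β) :* ((α :+ β) :* v :- α :* β :* u) :=
               (α :+ β) :* ((α :- β) :* v) :- α :* β :* ((α :- β) :* u)) refl α β u v ⟩
        (α + β) * ((α - β) * v) - α * β * ((α - β) * u)
          ≈⟨ +-cong (*-congˡ eqᵥ) (-‿cong (*-congˡ eqᵤ)) ⟩
        (α + β) * (α ^ suc n - β ^ suc n) - α * β * (α ^ n - β ^ n)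
          ≈⟨ solve 4 (λ α β a b → (α :+ β) :* (α :* a :- β :* b) :- α :* β :* (a :- b) :=
               α :* (α :* a) :- β :* (β :* b)) refl α β (α ^ n) (β ^ n) ⟩
        α ^ suc (suc n) - β ^ suc (suc n) ∎

      binet : ∀ n → (α - β) * U (+ n) ≈ α ^ n - β ^ n
      binet zero = begin
        (α - β) * U 0ℤ  ≈⟨ *-congˡ U₀≈0 ⟩
        (α - β) * 0#    ≈⟨ solve 1 (λ x → x :* con 0ℤ := con 1ℤ :- con 1ℤ) refl _ ⟩
        1# - 1#         ∎
      binet (suc zero) = begin
        (α - β) * U 1ℤ     ≈⟨ *-congˡ U₁≈1 ⟩
        (α - β) * 1#       ≈⟨ solve 2 (λ α β → (α :- β) :* con 1ℤ := α :* con 1ℤ :- β :* con 1ℤ) refl α β ⟩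
        α * 1# - β * 1#    ∎
      binet (suc (suc n)) = begin
        (α - β) * U (+ suc (suc n))
          ≡⟨ ≡.cong (λ k → (α - β) * U (+ k)) (≡.trans (ℕ.+-comm (n ℕ.+ 1) 1) (≡.cong suc (ℕ.+-comm n 1))) ⟨
        (α - β) * U (+ n ℤ.+ 1ℤ ℤ.+ 1ℤ)
          ≈⟨ *-congˡ (recurrence (+ n)) ⟩
        (α - β) * (P * U (+ (n ℕ.+ 1)) - Q * U (+ n))
          ≡⟨ ≡.cong (λ k → (α - β) * (P * U (+ k) - Q * U (+ n))) (ℕ.+-comm n 1) ⟩
        (α - β) * (P * U (+ suc n) - Q * U (+ n))
          ≈⟨ binet-step n (binet n) (binet (suc n)) ⟩
        α ^ suc (suc n) - β ^ suc (suc n) ∎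

      -- Writing the larger index as `m = k + e`, everything rests on `αᵏ βᵏ (αᵉ - βᵉ) = (αᵐ - βᵐ)
      -- βᵏ - (αᵏ - βᵏ) βᵐ`, where the powers of `β` alone cancel and `αᵏ βᵏ` is `Qᵏ`.
      pair-identity : ∀ k e {x y z} → (Uₖ#0 : U (+ k) # 0#) → (Uₖ₊ₑ#0 : U (+ (k ℕ.+ e)) # 0#) →
        U (+ k) * x ≈ β ^ k → U (+ (k ℕ.+ e)) * y ≈ β ^ (k ℕ.+ e) → U (+ (k ℕ.+ e)) * U (+ k) * z ≈ U (+ e) →
        Q ^ k * z ≈ x - y
      pair-identity k e {x} {y} {z} Uₖ#0 Uₖ₊ₑ#0 x-eq y-eq z-eq =
        *-cancelˡ-# (x#0y#0→xy#0 α-β#0 (x#0y#0→xy#0 Uₖ₊ₑ#0 Uₖ#0)) (begin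
        (α - β) * (v * u) * (Q ^ k * z)
          ≈⟨ solve 5 (λ d u v q z → d :* (v :* u) :* (q :* z) := q :* (d :* (v :* u :* z))) refl (α - β) u v (Q ^ k) z ⟩
        Q ^ k * ((α - β) * (v * u * z))
          ≈⟨ *-cong (trans (^-congˡ k (sym αβ≈Q)) (^-distrib-* α β k)) (*-congˡ z-eq) ⟩
        α ^ k * β ^ k * ((α - β) * U (+ e))
          ≈⟨ *-congˡ (binet e) ⟩
        α ^ k * β ^ k * (α ^ e - β ^ e)
          ≈⟨ solve 4 (λ a b a′ b′ → a :* b :* (a′ :- b′) := (a :* a′ :- b :* b′) :* b :- (a :- b) :* (b :* b′))
               refl (α ^ k) (β ^ k) (α ^ e) (β ^ e) ⟩
        (α ^ k * α ^ e - β ^ k * β ^ e) * β ^ k - (α ^ k - β ^ k) * (β ^ k * β ^ e)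
          ≈⟨ +-cong (*-congʳ (+-cong (^-homo-* α k e) (-‿cong (^-homo-* β k e)))) (-‿cong (*-congˡ (^-homo-* β k e))) ⟨
        (α ^ (k ℕ.+ e) - β ^ (k ℕ.+ e)) * β ^ k - (α ^ k - β ^ k) * β ^ (k ℕ.+ e)
          ≈⟨ +-cong (*-cong (binet (k ℕ.+ e)) x-eq) (-‿cong (*-cong (binet k) y-eq)) ⟨
        (α - β) * v * (u * x) - (α - β) * u * (v * y)
          ≈⟨ solve 5 (λ d u v x y → d :* v :* (u :* x) :- d :* u :* (v :* y) := d :* (v :* u) :* (x :- y))
               refl (α - β) u v x y ⟩
        (α - β) * (v * u) * (x - y) ∎)
        where
        u v : Carrier
        u = U (+ k)
        v = U (+ (k ℕ.+ e))

  module _ {α β : Carrier} (∣β∣<∣α∣ : ∣ β ∣ < ∣ α ∣) where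

    α#0 : α # 0#
    α#0 = #-congʳ (trans (+-congˡ -0#≈0#) (+-identityʳ α)) (∣y∣<∣x∣⇒x#y
      (≤-<-trans (≤-trans (≤-reflexive (0≤x⇒∣x∣≈x (≤-reflexive refl))) (0≤∣x∣ β)) ∣β∣<∣α∣))

    ρ : Carrier
    ρ = β / α [ α#0 ]

    αρ≈β : α * ρ ≈ β
    αρ≈β = y*[x/y]≈x α#0

    αⁿρⁿ≈βⁿ : ∀ n → α ^ n * ρ ^ n ≈ β ^ n
    αⁿρⁿ≈βⁿ n = trans (sym (^-distrib-* α ρ n)) (^-congˡ n αρ≈β)

    ∣ρ∣<1 : ∣ ρ ∣ < 1#
    ∣ρ∣<1 = *-cancelˡ-< (x#0⇒0<∣x∣ α#0) (begin-strict
      ∣ α ∣ * ∣ ρ ∣  ≈⟨ ∣x*y∣≈∣x∣*∣y∣ α ρ ⟨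
      ∣ α * ρ ∣      ≈⟨ ∣∣-cong αρ≈β ⟩
      ∣ β ∣          <⟨ ∣β∣<∣α∣ ⟩
      ∣ α ∣          ≈⟨ *-identityʳ _ ⟨
      ∣ α ∣ * 1#     ∎)
      where open ≤-Reasoning

    module _ (β#0 : β # 0#) where

      0<∣ρ∣ : 0# < ∣ ρ ∣
      0<∣ρ∣ = x#0⇒0<∣x∣ (xy#0⇒y#0 (#-congʳ (sym αρ≈β) β#0))

      -- For `n ≥ 1` the power `∣ρ∣ⁿ` is at most `∣ρ∣`. The bound does not depend on `n`; it serves
      -- both the nonvanishing of `Uₙ` and the estimate of the terms.
      1-∣ρ∣≤1-ρⁿ : ∀ n .{{_ : NonZero n}} → 1# - ∣ ρ ∣ ≤ 1# - ρ ^ n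
      1-∣ρ∣≤1-ρⁿ n = begin
        1# - ∣ ρ ∣      ≈⟨ +-congˡ (-‿cong (*-identityʳ _)) ⟨
        1# - ∣ ρ ∣ ^ 1  ≤⟨ +-monoʳ-≤ 1# (-‿anti-mono-≤ (^-antitone 0<∣ρ∣ (<⇒≤ ∣ρ∣<1) (ℕ.>-nonZero⁻¹ n))) ⟩
        1# - ∣ ρ ∣ ^ n  ≈⟨ +-congˡ (-‿cong (∣x^n∣≈∣x∣^n ρ n)) ⟨
        1# - ∣ ρ ^ n ∣  ≤⟨ +-monoʳ-≤ 1# (-‿anti-mono-≤ (x≤∣x∣ (ρ ^ n))) ⟩
        1# - ρ ^ n      ∎
        where open ≤-Reasoning

      0<1-ρⁿ : ∀ n .{{_ : NonZero n}} → 0# < 1# - ρ ^ n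
      0<1-ρⁿ n = <-≤-trans (x<y⇒0<y-x ∣ρ∣<1) (1-∣ρ∣≤1-ρⁿ n)

      αⁿ[1-ρⁿ]≈αⁿ-βⁿ : ∀ n → α ^ n * (1# - ρ ^ n) ≈ α ^ n - β ^ n
      αⁿ[1-ρⁿ]≈αⁿ-βⁿ n = begin
        α ^ n * (1# - ρ ^ n)      ≈⟨ solve 2 (λ a p → a :* (con 1ℤ :- p) := a :- a :* p) refl _ _ ⟩
        α ^ n - α ^ n * ρ ^ n     ≈⟨ +-congˡ (-‿cong (αⁿρⁿ≈βⁿ n)) ⟩
        α ^ n - β ^ n             ∎
        where open SetoidReasoning setoid

      αⁿ-βⁿ#0 : ∀ n .{{_ : NonZero n}} → α ^ n - β ^ n # 0#
      αⁿ-βⁿ#0 n = #-congʳ (αⁿ[1-ρⁿ]≈αⁿ-βⁿ n) (x#0y#0→xy#0 (^-#0 α#0 n) (#-sym (<⇒# (0<1-ρⁿ n))))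

      -- Dividing by αⁿ turns δ βⁿ / (αⁿ - βⁿ) into δ ρⁿ / (1 - ρⁿ).
      ratio-bound : ∀ {δ u x} n .{{_ : NonZero n}} → δ * u ≈ α ^ n - β ^ n → u * x ≈ β ^ n →
        (1# - ∣ ρ ∣) * ∣ x ∣ ≤ ∣ δ ∣ * ∣ ρ ∣ ^ n
      ratio-bound {δ} {u} {x} n δu≈αⁿ-βⁿ ux≈βⁿ = begin
        (1# - ∣ ρ ∣) * ∣ x ∣     ≈⟨ *-comm _ _ ⟩
        ∣ x ∣ * (1# - ∣ ρ ∣)     ≤⟨ *-monoˡ-≤ (0≤∣x∣ x) (1-∣ρ∣≤1-ρⁿ n) ⟩
        ∣ x ∣ * (1# - ρ ^ n)     ≈⟨ *-congˡ (0≤x⇒∣x∣≈x (<⇒≤ (0<1-ρⁿ n))) ⟨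
        ∣ x ∣ * ∣ 1# - ρ ^ n ∣   ≈⟨ ∣x*y∣≈∣x∣*∣y∣ x _ ⟨
        ∣ x * (1# - ρ ^ n) ∣     ≈⟨ ∣∣-cong x[1-ρⁿ]≈δρⁿ ⟩
        ∣ δ * ρ ^ n ∣            ≈⟨ ∣x*y∣≈∣x∣*∣y∣ δ _ ⟩
        ∣ δ ∣ * ∣ ρ ^ n ∣        ≈⟨ *-congˡ (∣x^n∣≈∣x∣^n ρ n) ⟩
        ∣ δ ∣ * ∣ ρ ∣ ^ n        ∎
        where
        open ≤-Reasoning
        x[1-ρⁿ]≈δρⁿ : x * (1# - ρ ^ n) ≈ δ * ρ ^ n
        x[1-ρⁿ]≈δρⁿ = *-cancelˡ-# (^-#0 α#0 n) (R.begin
          α ^ n * (x * (1# - ρ ^ n))   R.≈⟨ solve 3 (λ a x p → a :* (x :* p) := a :* p :* x) refl _ x _ ⟩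
          α ^ n * (1# - ρ ^ n) * x     R.≈⟨ *-congʳ (αⁿ[1-ρⁿ]≈αⁿ-βⁿ n) ⟩
          (α ^ n - β ^ n) * x          R.≈⟨ *-congʳ δu≈αⁿ-βⁿ ⟨
          δ * u * x                    R.≈⟨ *-assoc δ u x ⟩
          δ * (u * x)                  R.≈⟨ *-congˡ ux≈βⁿ ⟩
          δ * β ^ n                    R.≈⟨ *-congˡ (αⁿρⁿ≈βⁿ n) ⟨
          δ * (α ^ n * ρ ^ n)          R.≈⟨ solve 3 (λ d a p → d :* (a :* p) := a :* (d :* p)) refl δ _ _ ⟩
          α ^ n * (δ * ρ ^ n)          R.∎)
          where module R = SetoidReasoning setoid

-- The two series along the index sequence.

n≤a[n] : (a : ℕ → ℕ) → (∀ n → .{{NonZero n}} → 0 <ⁿ a n) →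
  (∀ m n → .{{NonZero m}} → m <ⁿ n → a m <ⁿ a n) → ∀ n .{{_ : NonZero n}} → n ℕ.≤ a n
-- The induction starts at `1`, since nothing is assumed about `a 0`.
n≤a[n] a pos mono (suc zero)        = pos 1
n≤a[n] a pos mono (suc n@(suc _)) = ℕ.≤-trans (s≤s (n≤a[n] a pos mono n)) (mono n (suc n) (ℕ.n<1+n n))

2n∸1<2n : ∀ n .{{_ : NonZero n}} → 2 *ⁿ n ∸ 1 <ⁿ 2 *ⁿ n
2n∸1<2n (suc n) = ℕ.n<1+n _

module AlternatingLucasSeries {c ℓ₁ ℓ₂} (ℝ : RealNumbers c ℓ₁ ℓ₂) where
  open RealNumbers ℝ
  open OrderedFieldProperties orderedField
  open Sequences orderedField
  open RealSeries ℝ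
  open DominantRoot orderedField

  module Summation {P Q α β : Carrier} (Q#0 : Q # 0#)
    (α-root : α ^ 2 - P * α + Q ≈ 0#) (β-root : β ^ 2 - P * β + Q ≈ 0#) (∣β∣<∣α∣ : ∣ β ∣ < ∣ α ∣)
    {U : ℤ → Carrier} (lucas : IsLucasSequence P Q U)
    {a : ℕ → ℕ} (a-pos : ∀ n → .{{NonZero n}} → 0 <ⁿ a n)
    (a-mono : ∀ m n → .{{NonZero m}} → m <ⁿ n → a m <ⁿ a n) where

    α-β#0 : α - β # 0#
    α-β#0 = ∣y∣<∣x∣⇒x#y ∣β∣<∣α∣

    -- Here `Q # 0#` enters, through `α * β ≈ Q`. It makes the ratio `r` of the dominating geometric
    -- series strictly positive.
    β#0 : β # 0#
    β#0 = xy#0⇒y#0 (#-congʳ (sym (αβ≈Q α-root β-root α-β#0)) Q#0)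

    r : Carrier
    r = ∣ ρ ∣β∣<∣α∣ ∣

    0<r : 0# < r
    0<r = 0<∣ρ∣ ∣β∣<∣α∣ β#0

    r<1 : r < 1#
    r<1 = ∣ρ∣<1 ∣β∣<∣α∣

    δUₙ : ∀ n → (α - β) * U (+ n) ≈ α ^ n - β ^ n
    δUₙ = binet α-root β-root α-β#0 lucas

    a≢0 : ∀ n .{{_ : NonZero n}} → NonZero (a n)
    a≢0 n = ℕ.>-nonZero (a-pos n)

    -- Unfolding this proof would make comparing two quotients by U (+ a n) prohibitively slow.
    abstract
      U#0 : ∀ n → .{{NonZero n}} → U (+ a n) # 0#
      U#0 n = xy#0⇒y#0 (#-congʳ (sym (δUₙ (a n))) (αⁿ-βⁿ#0 ∣β∣<∣α∣ β#0 (a n) {{a≢0 n}}))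

    X f g : (n : ℕ) → .{{NonZero n}} → Carrier
    X n = β ^ a n / U (+ a n) [ U#0 n ]
    f n = (- 1#) ^ n * X n
    g n = Q ^ a (2 *ⁿ n ∸ 1) *
      (U (+ a (2 *ⁿ n) -ᶻ + a (2 *ⁿ n ∸ 1)) /
      (U (+ a (2 *ⁿ n)) * U (+ a (2 *ⁿ n ∸ 1)))
      [ x#0y#0→xy#0 (U#0 (2 *ⁿ n) {{2n≢0 n}}) (U#0 (2 *ⁿ n ∸ 1) {{2n∸1≢0 n}}) ])

    f-bound : ∀ n .{{_ : NonZero n}} → (1# - r) * ∣ f n ∣ ≤ ∣ α - β ∣ * r ^ n
    f-bound n = begin
      (1# - r) * ∣ f n ∣        ≈⟨ *-congˡ (∣[-1]^n*x∣≈∣x∣ n (X n)) ⟩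
      (1# - r) * ∣ X n ∣        ≤⟨ X-bound ⟩
      ∣ α - β ∣ * r ^ a n       ≤⟨ *-monoˡ-≤ (0≤∣x∣ (α - β)) r^a[n]≤r^n ⟩
      ∣ α - β ∣ * r ^ n         ∎
      where
      open ≤-Reasoning
      X-bound : (1# - r) * ∣ X n ∣ ≤ ∣ α - β ∣ * r ^ a n
      X-bound = ratio-bound ∣β∣<∣α∣ β#0 (a n) {{a≢0 n}} (δUₙ (a n)) (y*[x/y]≈x (U#0 n))
      r^a[n]≤r^n : r ^ a n ≤ r ^ n
      r^a[n]≤r^n = ^-antitone 0<r (<⇒≤ r<1) (n≤a[n] a a-pos a-mono n)

    f-summable : ∃[ S ] HasSum f S
    f-summable = hasSum-geometricBound f ∣ α - β ∣ (0≤∣x∣ _) 0<r r<1 f-bound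

    S : Carrier
    S = proj₁ f-summable

    f⟶S : HasSum f S
    f⟶S = proj₂ f-summable

    pair : ∀ n .{{_ : NonZero n}} → g n ≈ - (f (2 *ⁿ n ∸ 1) {{2n∸1≢0 n}} + f (2 *ⁿ n) {{2n≢0 n}})
    pair n = begin
      g n
        ≈⟨ gap ⟩
      X₁ - X₂
        ≈⟨ solve 2 (λ x y → x :- y := :- (:- con 1ℤ :* x :+ con 1ℤ :* y)) refl X₁ X₂ ⟩
      - (- 1# * X₁ + 1# * X₂)
        ≈⟨ -‿cong (+-cong (*-congʳ ([-1]^[2n∸1]≈-1 n)) (*-congʳ ([-1]^[2n]≈1 n))) ⟨
      - ((- 1#) ^ (2 *ⁿ n ∸ 1) * X₁ + (- 1#) ^ (2 *ⁿ n) * X₂) ∎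
      where
      open SetoidReasoning setoid
      k m : ℕ
      k = a (2 *ⁿ n ∸ 1)
      m = a (2 *ⁿ n)

      U₁#0 = U#0 (2 *ⁿ n ∸ 1) {{2n∸1≢0 n}}
      U₂#0 = U#0 (2 *ⁿ n) {{2n≢0 n}}

      X₁ X₂ : Carrier
      X₁ = X (2 *ⁿ n ∸ 1) {{2n∸1≢0 n}}
      X₂ = X (2 *ⁿ n) {{2n≢0 n}}

      k≤m : k ℕ.≤ m
      k≤m = ℕ.<⇒≤ (a-mono (2 *ⁿ n ∸ 1) (2 *ⁿ n) {{2n∸1≢0 n}} (2n∸1<2n n))

      gap : g n ≈ X₁ - X₂
      -- The integer index `+ m -ᶻ + k` is the truncated difference `m ∸ k` because `k ≤ m`.
      gap = identity (≡.sym (ℕ.m+[n∸m]≡n k≤m)) U₂#0 (y*[x/y]≈x U₂#0)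
        (trans (y*[x/y]≈x _) (reflexive (≡.cong U (≡.trans (ℤ.[+m]-[+n]≡m⊖n m k) (ℤ.⊖-≥ k≤m)))))
        where
        -- The larger index is generalised to a variable, so that matching on `m ≡ k ℕ.+ e` replaces
        -- it in all hypotheses at once.
        identity : ∀ {m e y z} → m ≡ k ℕ.+ e → U (+ m) # 0# →
          U (+ m) * y ≈ β ^ m → U (+ m) * U (+ k) * z ≈ U (+ e) → Q ^ k * z ≈ X₁ - y
        identity {e = e} ≡.refl Uₘ#0 =
          pair-identity α-root β-root α-β#0 lucas k e U₁#0 Uₘ#0 (y*[x/y]≈x U₁#0)

theorem3p1 : ∀ {c ℓ₁ ℓ₂} (ℝ : RealNumbers c ℓ₁ ℓ₂) → let open RealNumbers ℝ in
    (P Q : Carrier) → P # 0# → Q # 0# → 0# < P ^ 2 - 4 · Q →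
    (α β : Carrier) → α ^ 2 - P * α + Q ≈ 0# → β ^ 2 - P * β + Q ≈ 0# → ∣ β ∣ < ∣ α ∣ →
    (U : ℤ → Carrier) → IsLucasSequence P Q U →
    (a : ℕ → ℕ) → (∀ n → .{{NonZero n}} → 0 <ⁿ a n) →
    (∀ m n → .{{NonZero m}} → m <ⁿ n → a m <ⁿ a n) →
    Σ[ U#0 ∈ (∀ n → .{{NonZero n}} → U (+ a n) # 0#) ] ∃[ S ] ∃[ T ]
    HasSum (λ n → (- 1#) ^ n * (β ^ a n / U (+ a n) [ U#0 n ])) S ×
    HasSum (λ n → Q ^ a (2 *ⁿ n ∸ 1) *
    (U (+ a (2 *ⁿ n) -ᶻ + a (2 *ⁿ n ∸ 1)) /
    (U (+ a (2 *ⁿ n)) * U (+ a (2 *ⁿ n ∸ 1)))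
    [ x#0y#0→xy#0 (U#0 (2 *ⁿ n) {{2n≢0 n}}) (U#0 (2 *ⁿ n ∸ 1) {{2n∸1≢0 n}}) ])) T ×
    S ≈ - T
theorem3p1 ℝ P Q _ Q#0 _ α β α-root β-root ∣β∣<∣α∣ U lucas a a-pos a-mono =
  U#0 , S , - S , f⟶S , hasSum-pairs f g pair f⟶S , sym (-‿involutive S)
  where
  open RealNumbers ℝ using (-_; sym; orderedField)
  open OrderedFieldProperties orderedField using (-‿involutive)
  open Sequences orderedField using (hasSum-pairs)
  open AlternatingLucasSeries ℝ
  open Summation Q#0 α-root β-root ∣β∣<∣α∣ lucas a-pos a-mono
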